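{- Let $G$ be a digraph. Then $G^{\top\bot}$ is congruence modular (i.e. has Gumm polymorphisms) if and only if $G^{\top\bot}$ is congruence distributive (i.e. has Jónsson polymorphisms).
   Context: Digraphs are finite and loopless: $G=(V,E)$ with $E\subseteq V\times V$. $G^{\top}$ is the digraph on $V\cup\{\top\}$ ($\top\notin V$ new) with edge set $E\cup\{(v,\top):v\in V\}$; $G^\bot$ is the digraph on $V\cup\{\bot\}$ with edge set $E\cup\{(\bot,v):v\in V\}$; $G^{\top\bot}=(G^\top)^\bot$. A polymorphism of arity $k$ is a map $f:V^k\to V$ with $(f(a_1,\dots,a_k),f(b_1,\dots,b_k))\in E$ whenever all $(a_i,b_i)\in E$. Gumm polymorphisms: ternary polymorphisms $s_0,\dots,s_{2n},p$ with $s_0(x,y,z)=x$; $s_i(x,y,x)=x$ for all $i\le 2n$; $s_i(x,y,y)=s_{i+1}(x,y,y)$ for even $i<2n$; $s_i(x,x,y)=s_{i+1}(x,x,y)$ for odd $i<2n$; $s_{2n}(x,y,y)=p(x,y,y)$; $p(x,x,y)=y$ (identically on the vertex set). Jónsson polymorphisms: ternary polymorphisms $J_0,\dots,J_n$ with $J_0(x,y,z)=x$; $J_i(x,y,x)=x$ for all $i\le n$; $J_i(x,x,y)=J_{i+1}(x,x,y)$ for even $i<n$; $J_i(x,y,y)=J_{i+1}(x,y,y)$ for odd $i<n$; $J_n(x,y,z)=z$. -}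

module Defs where

open import Data.Fin.Base using (Fin; zero; suc; toℕ; fromℕ; inject₁)
open import Data.Maybe.Base using (Maybe; just; nothing)
open import Data.Nat.Base using (ℕ; suc; _*_; parity)
open import Data.Parity.Base using (0ℙ; 1ℙ)
open import Data.Vec.Base using (Vec; []; _∷_)
open import Data.Vec.Relation.Binary.Pointwise.Inductive using (Pointwise)
open import Function.Bundles using (_↔_; mk↔ₛ′; Inverse)
open import Level using (0ℓ)
open import Relation.Binary.Core using (Rel; _Preserves_⟶_)
open import Relation.Binary.Definitions using (Decidable; Irreflexive)
open import Relation.Binary.PropositionalEquality.Core using (_≡_; refl; cong)
open import Relation.Nullary.Construct.Add.Infimum using (_₋)
open import Relation.Nullary.Construct.Add.Supremum using (_⁺)
import Relation.Binary.Construct.Add.Infimum.Strict as Infimum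
import Relation.Binary.Construct.Add.Supremum.Strict as Supremum

-- Membership in E ⊆ V × V is required to be decidable: this is how a subset of
-- a finite set is rendered constructively (classically it is no restriction).
record Digraph : Set₁ where
  infix 4 _⇾_
  field
    V          : Set
    _⇾_        : Rel V 0ℓ
    size       : ℕ
    enumerate  : V ↔ Fin size
    _⇾?_       : Decidable _⇾_
    ⇾-loopless : Irreflexive _≡_ _⇾_

open Digraph using (V)

Maybe↔Fin : ∀ {A : Set} {n} → A ↔ Fin n → Maybe A ↔ Fin (suc n)
Maybe↔Fin {A} {n} A↔Fin = mk↔ₛ′ f g f∘g g∘f
  where
  open Inverse A↔Fin using (to; from; strictlyInverseˡ; strictlyInverseʳ)

  f : Maybe A → Fin (suc n)
  f nothing  = zero
  f (just a) = suc (to a)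

  g : Fin (suc n) → Maybe A
  g zero    = nothing
  g (suc i) = just (from i)

  f∘g : ∀ i → f (g i) ≡ i
  f∘g zero    = refl
  f∘g (suc i) = cong suc (strictlyInverseˡ i)

  g∘f : ∀ a → g (f a) ≡ a
  g∘f nothing  = refl
  g∘f (just a) = cong just (strictlyInverseʳ a)

infixl 8 _^⊤ _^⊥ _^⊤⊥

-- The library phrases the extended relations for strict orders, but they are
-- defined for an arbitrary relation: _<⁺_ adds exactly the pairs (v , ⊤) with
-- v an old vertex, and _<₋_ exactly the pairs (⊥ , v) with v an old vertex.

_^⊤ : Digraph → Digraph
G ^⊤ = record
  { V          = G.V ⁺
  ; _⇾_        = Supremum._<⁺_ G._⇾_
  ; enumerate  = Maybe↔Fin G.enumerate
  ; _⇾?_       = Supremum.<⁺-dec G._⇾_ G._⇾?_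
  ; ⇾-loopless = Supremum.<⁺-irrefl-≡ G._⇾_ G.⇾-loopless
  } where module G = Digraph G

_^⊥ : Digraph → Digraph
G ^⊥ = record
  { V          = G.V ₋
  ; _⇾_        = Infimum._<₋_ G._⇾_
  ; enumerate  = Maybe↔Fin G.enumerate
  ; _⇾?_       = Infimum.<₋-dec G._⇾_ G._⇾?_
  ; ⇾-loopless = Infimum.<₋-irrefl-≡ G._⇾_ G.⇾-loopless
  } where module G = Digraph G

_^⊤⊥ : Digraph → Digraph
G ^⊤⊥ = (G ^⊤) ^⊥

record Polymorphism (G : Digraph) (k : ℕ) : Set where
  open Digraph G using (_⇾_)
  field
    op        : Vec (V G) k → V G
    preserves : op Preserves Pointwise _⇾_ ⟶ _⇾_

infix 9 _⟨_,_,_⟩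

_⟨_,_,_⟩ : ∀ {G} → Polymorphism G 3 → V G → V G → V G → V G
f ⟨ x , y , z ⟩ = Polymorphism.op f (x ∷ y ∷ z ∷ [])

-- In both records below, the indices i and i + 1 in an identity linking
-- consecutive operations are inject₁ i and suc i.

record GummPolymorphisms (G : Digraph) : Set where
  field
    n       : ℕ
    s       : Fin (suc (2 * n)) → Polymorphism G 3
    p       : Polymorphism G 3
    s-first : ∀ x y z → s zero ⟨ x , y , z ⟩ ≡ x
    s-xyx   : ∀ i x y → s i ⟨ x , y , x ⟩ ≡ x
    s-even  : ∀ (i : Fin (2 * n)) → parity (toℕ i) ≡ 0ℙ →
              ∀ x y → s (inject₁ i) ⟨ x , y , y ⟩ ≡ s (suc i) ⟨ x , y , y ⟩
    s-odd   : ∀ (i : Fin (2 * n)) → parity (toℕ i) ≡ 1ℙ →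
              ∀ x y → s (inject₁ i) ⟨ x , x , y ⟩ ≡ s (suc i) ⟨ x , x , y ⟩
    s-last  : ∀ x y → s (fromℕ (2 * n)) ⟨ x , y , y ⟩ ≡ p ⟨ x , y , y ⟩
    p-xxy   : ∀ x y → p ⟨ x , x , y ⟩ ≡ y

record JonssonPolymorphisms (G : Digraph) : Set where
  field
    n       : ℕ
    J       : Fin (suc n) → Polymorphism G 3
    J-first : ∀ x y z → J zero ⟨ x , y , z ⟩ ≡ x
    J-xyx   : ∀ i x y → J i ⟨ x , y , x ⟩ ≡ x
    J-even  : ∀ (i : Fin n) → parity (toℕ i) ≡ 0ℙ →
              ∀ x y → J (inject₁ i) ⟨ x , x , y ⟩ ≡ J (suc i) ⟨ x , x , y ⟩
    J-odd   : ∀ (i : Fin n) → parity (toℕ i) ≡ 1ℙ →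
              ∀ x y → J (inject₁ i) ⟨ x , y , y ⟩ ≡ J (suc i) ⟨ x , y , y ⟩
    J-last  : ∀ x y z → J (fromℕ n) ⟨ x , y , z ⟩ ≡ z

CongruenceModular : Digraph → Set
CongruenceModular = GummPolymorphisms

CongruenceDistributive : Digraph → Set
CongruenceDistributive = JonssonPolymorphisms

{-# OPTIONS --safe #-}
-- In G^⊤⊥ every edge source has an edge to ⊤ and every edge target has one from ⊥.
-- So if a polymorphism p has p(x,x,y) = y and (x,y,z) → (x′,y′,z′) edgewise,
-- then (x,y,z) → (⊤,⊤,z′) gives p(x,y,z) → z′, and (⊥,⊥,z) → (x′,y′,z′) gives
-- z → p(x′,y′,z′). Hence choosing between p(x,y,z) and z arbitrarily at each triple
-- always yields a polymorphism. Choosing p exactly when y = z yields q with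
-- q(x,x,y) = y, q(x,y,y) = p(x,y,y) and q(x,y,x) = x, and then
-- π₁, s₀, …, s₂ₙ, q, π₃ is a Jónsson chain.
module Submission where

open import Defs
open import Data.Bool.Base using (Bool; true; false; if_then_else_)
open import Data.Fin.Base using (Fin; zero; suc; toℕ; fromℕ; inject₁)
open import Data.Fin.Properties using (inj⇒≟)
open import Data.Nat.Base using (ℕ; zero; suc; _+_; _*_; parity)
open import Data.Parity.Base using (Parity; 0ℙ; 1ℙ; _⁻¹)
open import Data.Parity.Properties using (suc-homo-⁻¹; *-homo-*)
open import Data.Vec.Base as Vec using ([]; _∷_)
open import Data.Vec.Functional using (Vector) renaming (_∷_ to _◂_)
open import Data.Vec.Relation.Binary.Pointwise.Inductive as Pointwise using ([]; _∷_)
open import Function.Base using (_∘_)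
open import Function.Bundles using (_⇔_; mk⇔)
open import Function.Properties.Inverse using (↔⇒↣)
open import Relation.Binary.Core using (Rel)
open import Relation.Binary.Definitions using (DecidableEquality; Reflexive)
open import Relation.Binary.PropositionalEquality
  using (_≡_; refl; sym; trans; cong; subst)
open import Relation.Nullary.Construct.Add.Infimum using (⊥₋; [_])
open import Relation.Nullary.Construct.Add.Supremum using (⊤⁺; [_])
open import Relation.Nullary.Decidable.Core using (does; yes; no)
open import Relation.Binary.Construct.Add.Infimum.Strict using (⊥₋<[_]; [_])
open import Relation.Binary.Construct.Add.Supremum.Strict using ([_]; [_]<⊤⁺)
open import Level using (0ℓ)

open Digraph using (V)

module _ {A : Set} where

  -- `R` is indexed by position, so alternating identities form one relation, and adding or removing
  -- a head entry shifts `R` by `suc`.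
  Linked : (ℕ → Rel A 0ℓ) → ∀ {n} → Vector A (suc n) → Set
  Linked R t = ∀ i → R (toℕ i) (t (inject₁ i)) (t (suc i))

  linked-◂ : ∀ (R : ℕ → Rel A 0ℓ) {n a} {t : Vector A (suc n)} →
             R 0 a (t zero) → Linked (R ∘ suc) t → Linked R (a ◂ t)
  linked-◂ R r l zero    = r
  linked-◂ R r l (suc i) = l i

  infixl 5 _∷ʳ_

  _∷ʳ_ : ∀ {n} → Vector A n → A → Vector A (suc n)
  _∷ʳ_ {zero}  t a _       = a
  _∷ʳ_ {suc n} t a zero    = t zero
  _∷ʳ_ {suc n} t a (suc i) = (t ∘ suc ∷ʳ a) i

  ∷ʳ-last : ∀ {n} (t : Vector A n) a → (t ∷ʳ a) (fromℕ n) ≡ a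
  ∷ʳ-last {zero}  t a = refl
  ∷ʳ-last {suc n} t a = ∷ʳ-last (t ∘ suc) a

  ∷ʳ-all : ∀ (P : A → Set) {n} {t : Vector A n} {a} →
           (∀ i → P (t i)) → P a → ∀ i → P ((t ∷ʳ a) i)
  ∷ʳ-all P {zero}  pt pa _       = pa
  ∷ʳ-all P {suc n} pt pa zero    = pt zero
  ∷ʳ-all P {suc n} pt pa (suc i) = ∷ʳ-all P (pt ∘ suc) pa i

  linked-∷ʳ : ∀ (R : ℕ → Rel A 0ℓ) {n} (t : Vector A (suc n)) {a} →
              Linked R t → R n (t (fromℕ n)) a → Linked R (t ∷ʳ a)
  linked-∷ʳ R {zero}  t l r zero    = r
  linked-∷ʳ R {suc n} t l r zero    = l zero
  linked-∷ʳ R {suc n} t l r (suc i) = linked-∷ʳ (R ∘ suc) (t ∘ suc) (l ∘ suc) r i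

-- Index truncated to at most `n`: composing a chain with it repeats the last entry as often as
-- needed.
clamp : ∀ n {m} → Fin m → Fin (suc n)
clamp n       zero    = zero
clamp zero    (suc i) = zero
clamp (suc n) (suc i) = suc (clamp n i)

clamp-last : ∀ n m → clamp n (fromℕ (n + m)) ≡ fromℕ n
clamp-last zero    zero    = refl
clamp-last zero    (suc m) = refl
clamp-last (suc n) m       = cong suc (clamp-last n m)

-- From position `n` on both neighbours are the same entry, so reflexivity supplies the link.
linked-clamp : ∀ {A : Set} (R : ℕ → Rel A 0ℓ) → (∀ k → Reflexive (R k)) →
               ∀ {n m} (t : Vector A (suc n)) → Linked R t → Linked R {m} (t ∘ clamp n)
linked-clamp R r {zero}  t l zero    = r 0
linked-clamp R r {zero}  t l (suc i) = r (suc (toℕ i))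
linked-clamp R r {suc n} t l zero    = l zero
linked-clamp R r {suc n} t l (suc i) =
  linked-clamp (R ∘ suc) (r ∘ suc) (t ∘ suc) (l ∘ suc) i

parity-suc : ∀ k {p} → parity k ≡ p → parity (suc k) ≡ p ⁻¹
-- At `suc k` the law speaks of `parity (suc (suc k))`, which reduces to `parity k`.
parity-suc k eq = trans (sym (suc-homo-⁻¹ (suc k))) (cong _⁻¹ eq)

parity-pred : ∀ k {p} → parity (suc k) ≡ p → parity k ≡ p ⁻¹
parity-pred k eq = trans (sym (suc-homo-⁻¹ k)) (cong _⁻¹ eq)

module _ {G : Digraph} where

  projection : ∀ {k} → Fin k → Polymorphism G k
  projection i = record
    { op        = λ v → Vec.lookup v i
    ; preserves = λ es → Pointwise.lookup es i
    }

  Link : Parity → Rel (Polymorphism G 3) 0ℓ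
  Link 0ℙ f g = ∀ x y → f ⟨ x , x , y ⟩ ≡ g ⟨ x , x , y ⟩
  Link 1ℙ f g = ∀ x y → f ⟨ x , y , y ⟩ ≡ g ⟨ x , y , y ⟩

  link-refl : ∀ p → Reflexive (Link p)
  link-refl 0ℙ x y = refl
  link-refl 1ℙ x y = refl

  link-cases : ∀ p {f g} → (p ≡ 0ℙ → Link 0ℙ f g) → (p ≡ 1ℙ → Link 1ℙ f g) → Link p f g
  link-cases 0ℙ even odd = even refl
  link-cases 1ℙ even odd = odd refl

  -- A Gumm chain opens with an (x,y,y) link, hence the shift. As `parity` reduces with period two,
  -- each relation composed with `suc` is definitionally the other, so prepending one operation
  -- turns either type of chain into the other.
  JonssonLink GummLink : ℕ → Rel (Polymorphism G 3) 0ℓ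
  JonssonLink k = Link (parity k)
  GummLink    k = Link (parity (suc k))

module Bounded
  (G : Digraph) (_≟_ : DecidableEquality (V G)) (⊤ ⊥ : V G)
  (source⇾⊤ : ∀ {a b} → Digraph._⇾_ G a b → Digraph._⇾_ G a ⊤)
  (⊥⇾target : ∀ {a b} → Digraph._⇾_ G a b → Digraph._⇾_ G ⊥ b)
  where

  open Digraph G using (_⇾_)

  module _ (p : Polymorphism G 3) (p-xxy : ∀ x y → p ⟨ x , x , y ⟩ ≡ y) where

    choice : Bool → V G → V G → V G → V G
    choice b x y z = if b then p ⟨ x , y , z ⟩ else z

    choice-preserves : ∀ b b′ {x y z x′ y′ z′} → x ⇾ x′ → y ⇾ y′ → z ⇾ z′ →
                       choice b x y z ⇾ choice b′ x′ y′ z′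
    choice-preserves true true ex ey ez = Polymorphism.preserves p (ex ∷ ey ∷ ez ∷ [])
    choice-preserves true false ex ey ez =
      subst (_ ⇾_) (p-xxy ⊤ _)
        (Polymorphism.preserves p (source⇾⊤ ex ∷ source⇾⊤ ey ∷ ez ∷ []))
    choice-preserves false true ex ey ez =
      subst (_⇾ _) (p-xxy ⊥ _)
        (Polymorphism.preserves p (⊥⇾target ex ∷ ⊥⇾target ey ∷ ez ∷ []))
    choice-preserves false false ex ey ez = ez

    q : Polymorphism G 3
    q = record
      { op        = λ { (x ∷ y ∷ z ∷ []) → choice (does (y ≟ z)) x y z }
      ; preserves = λ { {_ ∷ y ∷ z ∷ []} {_ ∷ y′ ∷ z′ ∷ []} (ex ∷ ey ∷ ez ∷ []) →
                        choice-preserves (does (y ≟ z)) (does (y′ ≟ z′)) ex ey ez }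
      }

    q-xyx : ∀ x y → q ⟨ x , y , x ⟩ ≡ x
    q-xyx x y with y ≟ x
    ... | yes refl = p-xxy x x
    ... | no  _    = refl

    q-xxy : ∀ x y → q ⟨ x , x , y ⟩ ≡ y
    q-xxy x y with x ≟ y
    ... | yes _ = p-xxy x y
    ... | no  _ = refl

    q-xyy : ∀ x y → p ⟨ x , y , y ⟩ ≡ q ⟨ x , y , y ⟩
    q-xyy x y with y ≟ y
    ... | yes _ = refl
    ... | no ¬e with () ← ¬e refl

  gumm⇒jonsson : GummPolymorphisms G → JonssonPolymorphisms G
  gumm⇒jonsson gumm = record
    -- `s` has 2n + 1 operations; with `π₁`, `q₀` and `π₃` there are 2n + 4, the last indexed 2n +
    -- 3.
    { n       = 3 + 2 * n
    ; J       = J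
    ; J-first = λ x y z → refl
    ; J-xyx   = J-xyx
    ; J-even  = λ i eq → subst (λ r → Link r (J (inject₁ i)) (J (suc i))) eq (J-linked i)
    ; J-odd   = λ i eq → subst (λ r → Link r (J (inject₁ i)) (J (suc i))) eq (J-linked i)
    ; J-last  = λ x y z → cong (_⟨ x , y , z ⟩) (∷ʳ-last (s ∷ʳ q₀) π₃)
    }
    where
    open GummPolymorphisms gumm

    q₀ π₁ π₃ : Polymorphism G 3
    q₀ = q p p-xxy
    π₁ = projection zero
    π₃ = projection (suc (suc zero))

    J : Vector (Polymorphism G 3) (4 + 2 * n)
    J = π₁ ◂ (s ∷ʳ q₀ ∷ʳ π₃)

    J-xyx : ∀ i x y → J i ⟨ x , y , x ⟩ ≡ x
    J-xyx zero    = λ x y → refl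
    J-xyx (suc i) = ∷ʳ-all XYX (∷ʳ-all XYX s-xyx (q-xyx p p-xxy)) (λ x y → refl) i
      where
      XYX : Polymorphism G 3 → Set
      XYX f = ∀ x y → f ⟨ x , y , x ⟩ ≡ x

    parity-2n : parity (2 * n) ≡ 0ℙ
    parity-2n = *-homo-* 2 n

    s-linked : Linked GummLink s
    s-linked i = link-cases (parity (suc (toℕ i)))
      -- An even `suc (toℕ i)` means an odd index, hence `s-odd` here.
      (λ eq → s-odd i (parity-pred (toℕ i) eq))
      (λ eq → s-even i (parity-pred (toℕ i) eq))

    s-q : GummLink (2 * n) (s (fromℕ (2 * n))) q₀
    s-q = subst (λ r → Link r (s (fromℕ (2 * n))) q₀) (sym (parity-suc (2 * n) parity-2n))
      (λ x y → trans (s-last x y) (q-xyy p p-xxy x y))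

    -- At the odd position 2n + 1 the link is the (x,x,y) identity, and both operations return y
    -- there.
    q-π₃ : GummLink (suc (2 * n)) ((s ∷ʳ q₀) (fromℕ (suc (2 * n)))) π₃
    q-π₃ rewrite parity-2n | ∷ʳ-last s q₀ = q-xxy p p-xxy

    J-linked : Linked JonssonLink J
    J-linked = linked-◂ JonssonLink (λ x y → sym (s-first x x y))
      (linked-∷ʳ GummLink (s ∷ʳ q₀) (linked-∷ʳ GummLink s s-linked s-q) q-π₃)

-- A Gumm chain starts with an (x,y,y) link and a Jónsson chain with an (x,x,y)
-- link, so J₀ is repeated at the front; Jₙ is repeated at the back until the last index is even.
jonsson⇒gumm : ∀ {G} → JonssonPolymorphisms G → GummPolymorphisms G
jonsson⇒gumm {G} jonsson = record
  -- This leaves 2n + 2 positions after the front copy of J₀, enough for the clamped chain to reach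
  -- Jₙ.
  { n       = suc n
  ; s       = s
  ; p       = J (fromℕ n)
  ; s-first = J-first
  ; s-xyx   = s-xyx
  ; s-even  = λ i eq → subst (λ r → Link r (s (inject₁ i)) (s (suc i)))
                         (parity-suc (toℕ i) eq) (s-linked i)
  ; s-odd   = λ i eq → subst (λ r → Link r (s (inject₁ i)) (s (suc i)))
                         (parity-suc (toℕ i) eq) (s-linked i)
  -- `2 * suc n` unfolds to the successor of `n + (suc n + 0)`, where the clamped chain is already
  -- at the operation chosen as `p`.
  ; s-last  = λ x y → cong (λ i → J i ⟨ x , y , y ⟩) (clamp-last n (suc n + 0))
  ; p-xxy   = λ x y → J-last x x y
  }
  where
  open JonssonPolymorphisms jonsson

  s : Vector (Polymorphism G 3) (suc (2 * suc n))
  s = J zero ◂ (J ∘ clamp n)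

  s-xyx : ∀ i x y → s i ⟨ x , y , x ⟩ ≡ x
  s-xyx zero    = J-xyx zero
  s-xyx (suc i) = J-xyx (clamp n i)

  J-linked : Linked JonssonLink J
  J-linked i = link-cases (parity (toℕ i)) (J-even i) (J-odd i)

  s-linked : Linked GummLink s
  s-linked = linked-◂ GummLink (λ x y → refl)
    (linked-clamp JonssonLink (link-refl ∘ parity) J J-linked)

module _ (G : Digraph) where

  open Digraph (G ^⊤⊥) using (_⇾_)

  -- An edge out of `a` rules out a = ⊤, the only vertex without an edge to ⊤. Dually, an edge into
  -- `b` rules out b = ⊥ in `⊥⇾target`.
  source⇾⊤ : ∀ {a b} → a ⇾ b → a ⇾ [ ⊤⁺ ]
  source⇾⊤ ⊥₋<[ _ ]      = ⊥₋<[ ⊤⁺ ]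
  source⇾⊤ [ [ _ ] ]     = [ [ _ ]<⊤⁺ ]
  source⇾⊤ [ [ v ]<⊤⁺ ]  = [ [ v ]<⊤⁺ ]

  ⊥⇾target : ∀ {a b} → a ⇾ b → ⊥₋ ⇾ b
  ⊥⇾target ⊥₋<[ v ] = ⊥₋<[ v ]
  ⊥⇾target [ _ ]    = ⊥₋<[ _ ]

theorem7p5 : (G : Digraph) → CongruenceModular (G ^⊤⊥) ⇔ CongruenceDistributive (G ^⊤⊥)
theorem7p5 G = mk⇔
  (Bounded.gumm⇒jonsson (G ^⊤⊥) (inj⇒≟ (↔⇒↣ (Digraph.enumerate (G ^⊤⊥))))
    [ ⊤⁺ ] ⊥₋ (source⇾⊤ G) (⊥⇾target G))
  jonsson⇒gumm
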